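{- Let $G$ be a connected graph and let $(G,X,H,f)$ be an uncolorable degree-feasible configuration. Then the following statements hold: (a) $\sum_{x\in X_u}f(x)=d_G(u)$ for all $u\in V(G)$. (b) If $v\in V(G)$ is not a separating vertex of $G$ and $x_v\in X_v$ satisfies $f(x_v)>0$, then, for every $u\in V(G-v)$, we have $f(y)\ge\mu_H(y,x_v)$ for all $y\in X_u$ and $\mu_G(v,u)=\sum_{y\in X_u}\mu_H(y,x_v)$. (c) If $|G|\ge 2$ and $u$ is an arbitrary vertex of $G$, then there is a partial transversal $T$ of $(X,H)$ such that $\mathrm{dom}(T:G)=V(G-u)$ and $H[T]$ is strictly $f$-degenerate, and, for every such $T$ and every vertex $x\in X_u$, we have $f(x)=d_{H[T\cup\{x\}]}(x)$.
   Context: $\mathbb{N}_0=\{0,1,2,\dots\}$. Graphs are finite, undirected, may have multiple edges, no loops; connected graphs are non-empty. $|G|$ is the number of vertices, $\mu_G(u,v)$ is the number of edges joining $u$ and $v$; $d_G(v)$ is the number of edges incident with $v$. A separating vertex of a connected graph is a vertex whose deletion leaves at least two components. A cover of $G$ is a pair $(X,H)$ where $H$ is a graph and $X$ assigns to each $v\in V(G)$ a set $X_v\subseteq V(H)$ such that the sets $X_v$ are pairwise disjoint, $V(H)=\bigcup_v X_v$, each $X_v$ is independent in $H$, and for distinct $u,v\in V(G)$ the set of edges of $H$ between $X_u$ and $X_v$ is the union of $\mu_G(u,v)$ (possibly empty) matchings of $H$. A transversal of $(X,H)$ is a set $T\subseteq V(H)$ with $|T\cap X_v|=1$ for all $v\in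 V(G)$; a partial transversal satisfies $|T\cap X_v|\le1$ for all $v$; $\mathrm{dom}(T:G)=\{v\in V(G): X_v\cap T\ne\varnothing\}$. A configuration is a tuple $(G,X,H,f)$ where $G$ is a graph, $(X,H)$ is a cover of $G$ and $f:V(H)\to\mathbb{N}_0$. It is degree-feasible if $\sum_{x\in X_v}f(x)\ge d_G(v)$ for all $v\in V(G)$. A subgraph $\tilde H$ of $H$ is strictly $f$-degenerate if each non-empty subgraph $H'$ of $\tilde H$ contains a vertex $x$ with $d_{H'}(x)<f(x)$. The configuration is colorable if $(X,H)$ has a transversal $T$ such that $H[T]$ is strictly $f$-degenerate; otherwise it is uncolorable. -}

module Defs where

open import Data.Bool using (if_then_else_)
open import Data.Fin using (Fin; _≟_)
open import Data.Fin.Subset using (Subset; _∈_; _⊆_; _∩_; ⊤; ∁; ⁅_⁆; ∣_∣; Nonempty)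
open import Data.Fin.Subset.Properties using (_∈?_; nonempty?)
open import Data.Nat using (ℕ; _≤_; _<_)
open import Data.Nat.Properties using (+-0-commutativeMonoid)
open import Algebra.Properties.CommutativeMonoid.Sum +-0-commutativeMonoid using (sum)
open import Data.Product using (Σ; ∃; ∃₂; ∃-syntax; _×_; _,_; proj₁; proj₂)
open import Data.Sum using (_⊎_)
open import Data.Vec using (lookup; tabulate)
open import Data.Vec.Properties using (lookup∘tabulate; []=⇒lookup)
open import Function using (_⇔_)
open import Level using (Level)
open import Relation.Binary.Construct.Closure.ReflexiveTransitive using (Star)
open import Relation.Binary.PropositionalEquality using (_≡_; _≢_; sym; trans)
open import Relation.Nullary using (¬_; yes; no; does)
open import Relation.Nullary.Decidable using (_×-dec_; _⊎-dec_)
open import Relation.Unary using (Pred; Decidable)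

-- The subset { i ∣ P i }.
⟪_⟫ : ∀ {n} {ℓ : Level} {P : Pred (Fin n) ℓ} → Decidable P → Subset n
⟪ P? ⟫ = tabulate (λ i → does (P? i))

∈⟪⟫⁻ : ∀ {n} {ℓ : Level} {P : Pred (Fin n) ℓ} (P? : Decidable P) {i : Fin n} →
       i ∈ ⟪ P? ⟫ → P i
∈⟪⟫⁻ P? {i} i∈ with P? i | trans (sym (lookup∘tabulate (λ j → does (P? j)) i)) ([]=⇒lookup i∈)
... | yes p | _ = p
... | no _  | ()

sumOver : ∀ {n} → Subset n → (Fin n → ℕ) → ℕ
sumOver S f = sum (λ x → if lookup S x then f x else 0)

infix 5 sumOver
syntax sumOver S (λ x → t) = ∑[ x ∈ S ] t

-- Edges are named, so that parallel edges are distinct; the order of the two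
-- ends carries no meaning.
record Graph : Set where
  field
    order    : ℕ
    size     : ℕ
    ends     : Fin size → Fin order × Fin order
    loopless : ∀ e → proj₁ (ends e) ≢ proj₂ (ends e)

  Vertex : Set
  Vertex = Fin order

  Edge : Set
  Edge = Fin size

  end₁ end₂ : Edge → Vertex
  end₁ e = proj₁ (ends e)
  end₂ e = proj₂ (ends e)

open Graph public using (order; size; Vertex; Edge)

module _ (G : Graph) where
  open Graph G using (end₁; end₂)

  Incident : Vertex G → Edge G → Set
  Incident v e = v ≡ end₁ e ⊎ v ≡ end₂ e

  incident? : ∀ v → Decidable (Incident v)
  incident? v e = (v ≟ end₁ e) ⊎-dec (v ≟ end₂ e)

  Between : Subset (order G) → Subset (order G) → Edge G → Set
  Between A B e = (end₁ e ∈ A × end₂ e ∈ B) ⊎ (end₁ e ∈ B × end₂ e ∈ A)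

  Joins : Vertex G → Vertex G → Edge G → Set
  Joins u v e = (end₁ e ≡ u × end₂ e ≡ v) ⊎ (end₁ e ≡ v × end₂ e ≡ u)

  joins? : ∀ u v → Decidable (Joins u v)
  joins? u v e = (end₁ e ≟ u ×-dec end₂ e ≟ v) ⊎-dec (end₁ e ≟ v ×-dec end₂ e ≟ u)

  μ : Vertex G → Vertex G → ℕ
  μ u v = ∣ ⟪ joins? u v ⟫ ∣

  degree : Vertex G → ℕ
  degree v = ∣ ⟪ incident? v ⟫ ∣

  Independent : Subset (order G) → Set
  Independent S = ∀ e → ¬ (end₁ e ∈ S × end₂ e ∈ S)

  Matching : Subset (size G) → Set
  Matching M = ∀ {e e′ v} → e ∈ M → e′ ∈ M → Incident v e → Incident v e′ → e ≡ e′

  record Subgraph : Set where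
    field
      vertices : Subset (order G)
      edges    : Subset (size G)
      closed   : ∀ {e} → e ∈ edges → end₁ e ∈ vertices × end₂ e ∈ vertices

  open Subgraph

  infix 4 _⊑_
  _⊑_ : Subgraph → Subgraph → Set
  K ⊑ L = vertices K ⊆ vertices L × edges K ⊆ edges L

  degreeIn : Subgraph → Vertex G → ℕ
  degreeIn K v = ∣ edges K ∩ ⟪ incident? v ⟫ ∣

  bothEndsIn? : ∀ S → Decidable (λ e → end₁ e ∈ S × end₂ e ∈ S)
  bothEndsIn? S e = end₁ e ∈? S ×-dec end₂ e ∈? S

  induced : Subset (order G) → Subgraph
  induced S = record
    { vertices = S
    ; edges    = ⟪ bothEndsIn? S ⟫
    ; closed   = ∈⟪⟫⁻ (bothEndsIn? S)
    }

  whole : Subgraph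
  whole = induced ⊤

  delete : Vertex G → Subgraph
  delete v = induced (∁ ⁅ v ⁆)

  Adjacent : Subgraph → Vertex G → Vertex G → Set
  Adjacent K u v = ∃[ e ] e ∈ edges K × Joins u v e

  Walk : Subgraph → Vertex G → Vertex G → Set
  Walk K = Star (Adjacent K)

  Connected : Set
  Connected = Nonempty (vertices whole) × (∀ u v → Walk whole u v)

  -- Components are the classes of vertices under the existence of a walk, so
  -- there are at least two of them iff some two vertices lie in different ones.
  TwoComponents : Subgraph → Set
  TwoComponents K = ∃₂ λ a b → a ∈ vertices K × b ∈ vertices K × ¬ Walk K a b

  Separating : Vertex G → Set
  Separating v = TwoComponents (delete v)

  StrictlyDegenerate : (Vertex G → ℕ) → Subgraph → Set
  StrictlyDegenerate f K =
    ∀ K′ → K′ ⊑ K → Nonempty (vertices K′) →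
    ∃[ x ] x ∈ vertices K′ × degreeIn K′ x < f x

record Cover (G : Graph) : Set where
  field
    H           : Graph
    X           : Vertex G → Subset (order H)
    disjoint    : ∀ {u v x} → x ∈ X u → x ∈ X v → u ≡ v
    covering    : ∀ x → ∃[ v ] x ∈ X v
    independent : ∀ v → Independent H (X v)
    matchings   : ∀ u v → u ≢ v →
                  Σ (Fin (μ G u v) → Subset (size H)) λ M →
                    (∀ i → Matching H (M i)) ×
                    (∀ e → Between H (X u) (X v) e ⇔ (∃[ i ] e ∈ M i))

  Transversal : Subset (order H) → Set
  Transversal T = ∀ v → ∣ T ∩ X v ∣ ≡ 1

  PartialTransversal : Subset (order H) → Set
  PartialTransversal T = ∀ v → ∣ T ∩ X v ∣ ≤ 1

  dom : Subset (order H) → Subset (order G)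
  dom T = ⟪ (λ v → nonempty? (X v ∩ T)) ⟫

record Configuration : Set where
  field
    G     : Graph
    cover : Cover G

  open Cover cover public

  field
    f : Vertex H → ℕ

  DegreeFeasible : Set
  DegreeFeasible = ∀ v → degree G v ≤ (∑[ x ∈ X v ] f x)

  Colorable : Set
  Colorable = ∃[ T ] Transversal T × StrictlyDegenerate H f (induced H T)

  Uncolorable : Set
  Uncolorable = ¬ Colorable

{-# OPTIONS --safe #-}
module Submission where

-- Colour the vertices other than u greedily, in an order in which each still has
-- an uncoloured neighbour. The edges from X w to a partial transversal T number at
-- most Σ_{v ∈ dom T} μ(v,w) < d(w) ≤ Σ_{X w} f, so some x ∈ X w has fewer than f x
-- neighbours in T, and adding it keeps T strictly degenerate. At u itself,
-- uncolorability forces f x ≤ d(x) for all x ∈ X u, so that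
--   Σ f ≤ Σ d ≤ Σ_{w ∈ dom T} Σ_{z ∈ T ∩ X w} Σ_{y ∈ X u} μ(y,z) ≤ Σ_w μ(w,u) ≤ d(u) ≤ Σ f
-- collapses to termwise equalities. This gives (a) and (c); (b) follows when the
-- greedy colouring is started from {xᵥ} and continued in the connected graph G − v.

open import Defs
open import Data.Bool using (true; false; if_then_else_)
open import Data.Fin using (Fin; zero; suc; toℕ; _≟_)
open import Data.Fin.Properties using (any?; suc-injective)
open import Data.Fin.Subset using (Subset; inside; outside; _∈_; _∉_; _⊆_; _∩_; _∪_; _-_; ⊤; ⊥; ∁; ⁅_⁆; ∣_∣; Nonempty)
open import Data.Fin.Subset.Properties
open import Data.Nat using (ℕ; zero; suc; _+_; _≤_; _<_; _≥_; _>_; z≤n; s≤s)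
open import Data.Nat.Induction using (<-wellFounded)
open import Data.Nat.Properties hiding (_≟_; suc-injective)
open import Algebra.Properties.CommutativeMonoid.Sum +-0-commutativeMonoid using (sum; sum-cong-≗; sum-replicate-zero; ∑-comm)
open import Data.Product using (∃; ∃-syntax; _×_; _,_; proj₁; proj₂; map₂)
open import Data.Sum using (_⊎_; inj₁; inj₂; [_,_]′)
open import Data.Vec using (_∷_; []; lookup)
open import Data.Vec.Properties using (lookup∘tabulate; []=⇒lookup; lookup⇒[]=)
open import Function using (_∘_; id; const; Equivalence)
open import Level using (Level)
open import Induction.WellFounded using (Acc; acc)
open import Relation.Binary.Construct.Closure.ReflexiveTransitive using (ε; _◅_)
open import Relation.Binary.PropositionalEquality using (_≡_; _≢_; refl; sym; trans; cong; subst)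
open import Relation.Nullary using (¬_; Dec; yes; no; does; contradiction)
open import Relation.Nullary.Decidable using (_×-dec_; ¬?; dec-true)
open import Relation.Unary using (Pred; Decidable)

private variable
  m n k : ℕ

∈⟪⟫⁺ : {ℓ : Level} {P : Pred (Fin n) ℓ} (P? : Decidable P) {i : Fin n} → P i → i ∈ ⟪ P? ⟫
∈⟪⟫⁺ P? {i} p = lookup⇒[]= i _ (trans (lookup∘tabulate (does ∘ P?) i) (dec-true (P? i) p))

sum-mono-≤ : {f g : Fin n → ℕ} → (∀ i → f i ≤ g i) → sum f ≤ sum g
sum-mono-≤ {zero}  f≤g = z≤n
sum-mono-≤ {suc n} f≤g = +-mono-≤ (f≤g zero) (sum-mono-≤ (f≤g ∘ suc))

sum-mono-< : {f g : Fin n → ℕ} → (∀ i → f i ≤ g i) → ∀ i → f i < g i → sum f < sum g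
sum-mono-< f≤g zero    fi<gi = +-mono-<-≤ fi<gi (sum-mono-≤ (f≤g ∘ suc))
sum-mono-< f≤g (suc i) fi<gi = +-mono-≤-< (f≤g zero) (sum-mono-< (f≤g ∘ suc) i fi<gi)

term≤sum : (f : Fin n → ℕ) → ∀ i → f i ≤ sum f
term≤sum f zero    = m≤m+n _ _
term≤sum f (suc i) = ≤-trans (term≤sum (f ∘ suc) i) (m≤n+m _ (f zero))

sum-positive : (f : Fin n → ℕ) → 0 < sum f → ∃[ i ] 0 < f i
sum-positive {suc n} f 0<∑ with f zero in eq
... | suc _ = zero , subst (0 <_) (sym eq) (s≤s z≤n)
... | zero with sum-positive (f ∘ suc) 0<∑
...   | i , 0<fi = suc i , 0<fi

sum≤n : {f : Fin n → ℕ} → (∀ i → f i ≤ 1) → sum f ≤ n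
sum≤n {zero}  f≤1 = z≤n
sum≤n {suc n} f≤1 = +-mono-≤ (f≤1 zero) (sum≤n (f≤1 ∘ suc))

sum-single-≤ : (f : Fin n → ℕ) → (∀ i → f i ≤ k) →
               (∀ i j → 0 < f i → 0 < f j → i ≡ j) → sum f ≤ k
sum-single-≤ {zero}  f f≤k single = z≤n
sum-single-≤ {suc n} f f≤k single with f zero in eq | f≤k zero
... | zero  | _     = sum-single-≤ (f ∘ suc) (f≤k ∘ suc)
                        (λ i j p q → suc-injective (single (suc i) (suc j) p q))
... | suc a | a<k     = ≤-trans (≤-reflexive (trans (cong (suc a +_) rest) (+-identityʳ _))) a<k
  where
  rest : sum (f ∘ suc) ≡ 0
  rest = n≤0⇒n≡0 (≮⇒≥ λ 0<∑ → let j , 0<fj = sum-positive (f ∘ suc) 0<∑ in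
    0≢1+n (cong toℕ (single zero (suc j) (subst (0 <_) (sym eq) (s≤s z≤n)) 0<fj)))

restrict : Subset n → (Fin n → ℕ) → Fin n → ℕ
restrict S f x = if lookup S x then f x else 0

module _ (S : Subset n) (f : Fin n → ℕ) where

  restrict-∈ : ∀ {x} → x ∈ S → restrict S f x ≡ f x
  restrict-∈ {x} x∈S rewrite []=⇒lookup x∈S = refl

  restrict-∉ : ∀ {x} → x ∉ S → restrict S f x ≡ 0
  restrict-∉ {x} x∉S with lookup S x in eq
  ... | true  = contradiction (lookup⇒[]= x S eq) x∉S
  ... | false = refl

  restrict-positive : ∀ {x} → 0 < restrict S f x → x ∈ S × 0 < f x
  restrict-positive {x} 0<r with lookup S x in eq
  ... | true  = lookup⇒[]= x S eq , 0<r
  ... | false with () ← 0<r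

  restrict-≤ : ∀ {x k} → (x ∈ S → f x ≤ k) → restrict S f x ≤ k
  restrict-≤ {x} fx≤k with lookup S x in eq
  ... | true  = fx≤k (lookup⇒[]= x S eq)
  ... | false = z≤n

  ∈≤sumOver : ∀ {x} → x ∈ S → f x ≤ sumOver S f
  ∈≤sumOver {x} x∈S = subst (_≤ sumOver S f) (restrict-∈ x∈S) (term≤sum (restrict S f) x)

module _ {S : Subset n} {f : Fin n → ℕ} where

  sumOver-positive : 0 < sumOver S f → ∃[ x ] x ∈ S × 0 < f x
  sumOver-positive 0<∑ = map₂ (restrict-positive S f) (sum-positive (restrict S f) 0<∑)

  sumOver-single-≤ : (∀ {x} → x ∈ S → f x ≤ k) →
                     (∀ {x y} → x ∈ S → y ∈ S → 0 < f x → 0 < f y → x ≡ y) → sumOver S f ≤ k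
  sumOver-single-≤ f≤k single = sum-single-≤ (restrict S f) (λ x → restrict-≤ S f f≤k) λ x y p q →
    let x∈S , 0<fx = restrict-positive S f p
        y∈S , 0<fy = restrict-positive S f q
    in single x∈S y∈S 0<fx 0<fy

restrict-mono-≤ : (S T : Subset n) (f g : Fin n → ℕ) →
                  ∀ {x} → (x ∈ S → x ∈ T × f x ≤ g x) → restrict S f x ≤ restrict T g x
restrict-mono-≤ S T f g {x} h = restrict-≤ S f λ x∈S →
  let x∈T , fx≤gx = h x∈S in subst (f x ≤_) (sym (restrict-∈ T g x∈T)) fx≤gx

sumOver-≤ : {S : Subset n} {f g : Fin n → ℕ} →
            (∀ {x} → x ∈ S → f x ≤ g x) → sumOver S f ≤ sumOver S g
sumOver-≤ {S = S} {f} {g} f≤g =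
  sum-mono-≤ λ x → restrict-mono-≤ S S f g {x} λ x∈S → x∈S , f≤g x∈S

sumOver-⊂-< : {S T : Subset n} {f : Fin n → ℕ} → S ⊆ T →
              ∀ {x} → x ∈ T → x ∉ S → 0 < f x → sumOver S f < sumOver T f
sumOver-⊂-< {S = S} {T} {f} S⊆T {x} x∈T x∉S 0<fx =
  sum-mono-< (λ y → restrict-mono-≤ S T f f λ y∈S → S⊆T y∈S , ≤-refl) x
    (≤-trans (≤-trans (≤-reflexive (cong suc (restrict-∉ S f x∉S))) 0<fx) (≤-reflexive (sym (restrict-∈ T f x∈T))))

module _ {S : Subset n} {f g : Fin n → ℕ} where

  sumOver-<⇒∃< : sumOver S f < sumOver S g → ∃[ x ] x ∈ S × f x < g x
  sumOver-<⇒∃< ∑f<∑g with any? (λ x → x ∈? S ×-dec f x <? g x)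
  ... | yes found = found
  ... | no  none  = contradiction (sumOver-≤ {f = g} {f} λ {x} x∈S → ≮⇒≥ λ fx<gx → none (x , x∈S , fx<gx))
                                  (<⇒≱ ∑f<∑g)

  sumOver-≥⇒≡ : (∀ {x} → x ∈ S → f x ≤ g x) → sumOver S g ≤ sumOver S f →
                ∀ {x} → x ∈ S → f x ≡ g x
  sumOver-≥⇒≡ f≤g ∑g≤∑f {x} x∈S with m≤n⇒m<n∨m≡n (f≤g x∈S)
  ... | inj₂ fx≡gx = fx≡gx
  ... | inj₁ fx<gx = contradiction ∑g≤∑f (<⇒≱ (sum-mono-<
    (λ y → restrict-mono-≤ S S f g λ y∈S → y∈S , f≤g y∈S) x
    (≤-trans (≤-reflexive (cong suc (restrict-∈ S f x∈S)))
      (≤-trans fx<gx (≤-reflexive (sym (restrict-∈ S g x∈S)))))))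

sumOver-sum-comm : (S : Subset n) (h : Fin n → Fin m → ℕ) →
                   (∑[ x ∈ S ] sum (h x)) ≡ sum (λ y → ∑[ x ∈ S ] h x y)
sumOver-sum-comm {m = m} S h =
  trans (sum-cong-≗ λ x → pull (lookup S x)) (∑-comm (λ x y → restrict S (λ z → h z y) x))
  where
  pull : ∀ b {g : Fin m → ℕ} → (if b then sum g else 0) ≡ sum (λ y → if b then g y else 0)
  pull true  = refl
  pull false = sym (sum-replicate-zero m)

sumOver-comm : (S : Subset n) (T : Subset m) (h : Fin n → Fin m → ℕ) →
               (∑[ x ∈ S ] ∑[ y ∈ T ] h x y) ≡ (∑[ y ∈ T ] ∑[ x ∈ S ] h x y)
sumOver-comm {n = n} S T h =
  trans (sumOver-sum-comm S λ x → restrict T (h x)) (sum-cong-≗ λ y → pull (lookup T y))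
  where
  pull : ∀ b {g : Fin n → ℕ} → (∑[ x ∈ S ] (if b then g x else 0)) ≡ (if b then sumOver S g else 0)
  pull true  = refl
  pull false = trans (sum-cong-≗ λ x → zeros (lookup S x)) (sum-replicate-zero n)
    where
    zeros : ∀ c → (if c then 0 else 0) ≡ 0
    zeros true  = refl
    zeros false = refl

sumOver-cover-≤ : (T : Subset n) (D : Subset m) (F : Fin m → Subset n) (g : Fin n → ℕ) →
                  (∀ {z} → z ∈ T → ∃[ w ] w ∈ D × z ∈ F w) →
                  sumOver T g ≤ (∑[ w ∈ D ] ∑[ z ∈ F w ] g z)
sumOver-cover-≤ T D F g covered = ≤-trans (sum-mono-≤ pointwise)
  (≤-reflexive (sym (sumOver-sum-comm D λ w → restrict (F w) g)))
  where
  pointwise : ∀ z → restrict T g z ≤ (∑[ w ∈ D ] restrict (F w) g z)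
  pointwise z = restrict-≤ T g λ z∈T → let w , w∈D , z∈F = covered z∈T in
    subst (_≤ (∑[ w ∈ D ] restrict (F w) g z)) (restrict-∈ (F w) g z∈F)
      (∈≤sumOver D (λ w → restrict (F w) g z) w∈D)

χ : Subset n → Fin n → ℕ
χ S = restrict S (const 1)

∈⇒χ≡1 : {S : Subset n} {x : Fin n} → x ∈ S → χ S x ≡ 1
∈⇒χ≡1 {S = S} = restrict-∈ S (const 1)

χ-positive : {S : Subset n} {x : Fin n} → 0 < χ S x → x ∈ S
χ-positive {S = S} 0<χ = proj₁ (restrict-positive S (const 1) 0<χ)

∣∣≡sumχ : (S : Subset n) → ∣ S ∣ ≡ sum (χ S)
∣∣≡sumχ []            = refl
∣∣≡sumχ (inside ∷ S)  = cong suc (∣∣≡sumχ S)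
∣∣≡sumχ (outside ∷ S) = ∣∣≡sumχ S

double-count : (S : Subset n) (J : Fin n → Subset m) →
               (∑[ x ∈ S ] ∣ J x ∣) ≡ sum (λ e → ∑[ x ∈ S ] χ (J x) e)
double-count S J =
  trans (sum-cong-≗ λ x → cong (λ c → if lookup S x then c else 0) (∣∣≡sumχ (J x)))
        (sumOver-sum-comm S (χ ∘ J))

∣∣-unique : {S : Subset n} → ∣ S ∣ ≤ 1 → ∀ {x y} → x ∈ S → y ∈ S → x ≡ y
∣∣-unique ∣S∣≤1 {x} {y} x∈S y∈S with x ≟ y
... | yes x≡y = x≡y
... | no  x≢y = contradiction ∣S∣≤1 (<⇒≱ (≤-<-trans
  (≤-trans (s≤s z≤n) (x∈p⇒∣p-x∣<∣p∣ (x∈p∧x≢y⇒x∈p-y y∈S (x≢y ∘ sym)))) (x∈p⇒∣p-x∣<∣p∣ x∈S)))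

unique⇒∣∣≤1 : {S : Subset n} → (∀ {x y} → x ∈ S → y ∈ S → x ≡ y) → ∣ S ∣ ≤ 1
unique⇒∣∣≤1 {S = S} unique = ≤-trans (≤-reflexive (∣∣≡sumχ S))
  (sumOver-single-≤ {S = S} (λ _ → ≤-refl) λ x∈S y∈S _ _ → unique x∈S y∈S)

nonempty⇒∣∣≥1 : {S : Subset n} → Nonempty S → 1 ≤ ∣ S ∣
nonempty⇒∣∣≥1 (x , x∈S) = ≤-trans (s≤s z≤n) (x∈p⇒∣p-x∣<∣p∣ x∈S)

sum≤number-of-classes : (a : Fin m → ℕ) (M : Fin k → Subset m) → (∀ e → a e ≤ 1) →
  (∀ e → 0 < a e → ∃[ i ] e ∈ M i) →
  (∀ i {e e′} → e ∈ M i → e′ ∈ M i → 0 < a e → 0 < a e′ → e ≡ e′) → sum a ≤ k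
sum≤number-of-classes {k = k} a M a≤1 covered separated = begin
  sum a                                       ≤⟨ sum-mono-≤ pointwise ⟩
  sum (λ e → sum (λ i → restrict (M i) a e))  ≡⟨ ∑-comm (λ e i → restrict (M i) a e) ⟩
  sum (λ i → sumOver (M i) a)                 ≤⟨ sum≤n (λ i →
    sumOver-single-≤ {S = M i} {f = a} (λ {e} _ → a≤1 e) (separated i)) ⟩
  k                                           ∎
  where
  open ≤-Reasoning
  pointwise : ∀ e → a e ≤ sum (λ i → restrict (M i) a e)
  pointwise e with 0 <? a e
  ... | no  a≯0 = ≤-trans (≮⇒≥ a≯0) z≤n
  ... | yes a>0 = let i , e∈Mi = covered e a>0 in
    ≤-trans (≤-reflexive (sym (restrict-∈ (M i) a e∈Mi))) (term≤sum (λ i → restrict (M i) a e) i)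

module _ (K : Graph) where
  open Graph K using (end₁; end₂; loopless)

  joins⇒incidentʳ : ∀ {w u e} → Joins K w u e → Incident K u e
  joins⇒incidentʳ (inj₁ (_ , p)) = inj₂ (sym p)
  joins⇒incidentʳ (inj₂ (p , _)) = inj₁ (sym p)

  joins-uniqueˡ : ∀ {w w′ u e} → Joins K w u e → Joins K w′ u e → w ≡ w′
  joins-uniqueˡ         (inj₁ (p , _)) (inj₁ (q , _)) = trans (sym p) q
  joins-uniqueˡ {e = e} (inj₁ (_ , p)) (inj₂ (q , _)) = contradiction (trans q (sym p)) (loopless e)
  joins-uniqueˡ {e = e} (inj₂ (p , _)) (inj₁ (_ , q)) = contradiction (trans p (sym q)) (loopless e)
  joins-uniqueˡ         (inj₂ (_ , p)) (inj₂ (_ , q)) = trans (sym p) q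

  sum-μ≤degree : ∀ D u → (∑[ w ∈ D ] μ K w u) ≤ degree K u
  sum-μ≤degree D u = begin
    (∑[ w ∈ D ] μ K w u)               ≡⟨ double-count D J ⟩
    sum (λ e → ∑[ w ∈ D ] χ (J w) e)   ≤⟨ sum-mono-≤ pointwise ⟩
    sum (χ ⟪ incident? K u ⟫)          ≡⟨ ∣∣≡sumχ ⟪ incident? K u ⟫ ⟨
    degree K u                         ∎
    where
    open ≤-Reasoning
    J = λ w → ⟪ joins? K w u ⟫
    pointwise : ∀ e → (∑[ w ∈ D ] χ (J w) e) ≤ χ ⟪ incident? K u ⟫ e
    pointwise e = sumOver-single-≤ {S = D}
      (λ {w} _ → restrict-mono-≤ (J w) ⟪ incident? K u ⟫ (const 1) (const 1) λ e∈J →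
        ∈⟪⟫⁺ (incident? K u) (joins⇒incidentʳ (∈⟪⟫⁻ (joins? K w u) e∈J)) , ≤-refl)
      (λ {w} {w′} _ _ p q → joins-uniqueˡ (∈⟪⟫⁻ (joins? K w u) (χ-positive p))
                                          (∈⟪⟫⁻ (joins? K w′ u) (χ-positive q)))

  degreeIn-induced≤ : ∀ S x → degreeIn K (induced K (S ∪ ⁅ x ⁆)) x ≤ (∑[ y ∈ S ] μ K x y)
  degreeIn-induced≤ S x = begin
    ∣ E ∣                              ≡⟨ ∣∣≡sumχ E ⟩
    sum (χ E)                          ≤⟨ sum-mono-≤ (λ e → restrict-≤ E (const 1) (pointwise e)) ⟩
    sum (λ e → ∑[ y ∈ S ] χ (J y) e)   ≡⟨ double-count S J ⟨
    (∑[ y ∈ S ] μ K x y)               ∎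
    where
    open ≤-Reasoning
    J = λ y → ⟪ joins? K x y ⟫
    E = ⟪ bothEndsIn? K (S ∪ ⁅ x ⁆) ⟫ ∩ ⟪ incident? K x ⟫

    other-end∈S : ∀ {y} → y ≢ x → y ∈ S ∪ ⁅ x ⁆ → y ∈ S
    other-end∈S y≢x y∈ with x∈p∪q⁻ S ⁅ x ⁆ y∈
    ... | inj₁ y∈S = y∈S
    ... | inj₂ y∈x = contradiction (x∈⁅y⁆⇒x≡y x y∈x) y≢x

    neighbour : ∀ e → e ∈ E → ∃[ y ] y ∈ S × Joins K x y e
    neighbour e e∈E with x∈p∩q⁻ ⟪ bothEndsIn? K (S ∪ ⁅ x ⁆) ⟫ ⟪ incident? K x ⟫ e∈E
    ... | e∈S , e∈x with ∈⟪⟫⁻ (bothEndsIn? K (S ∪ ⁅ x ⁆)) e∈S | ∈⟪⟫⁻ (incident? K x) e∈x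
    ...   | _ , e₂∈ | inj₁ x≡e₁ = end₂ e , other-end∈S (λ e₂≡x → loopless e (sym (trans e₂≡x x≡e₁))) e₂∈
                                , inj₁ (sym x≡e₁ , refl)
    ...   | e₁∈ , _ | inj₂ x≡e₂ = end₁ e , other-end∈S (λ e₁≡x → loopless e (trans e₁≡x x≡e₂)) e₁∈
                                , inj₂ (refl , sym x≡e₂)

    pointwise : ∀ e → e ∈ E → 1 ≤ (∑[ y ∈ S ] χ (J y) e)
    pointwise e e∈E = let y , y∈S , joins = neighbour e e∈E in
      subst (_≤ (∑[ y ∈ S ] χ (J y) e)) (∈⇒χ≡1 (∈⟪⟫⁺ (joins? K x y) joins))
        (∈≤sumOver S (λ y → χ (J y) e) y∈S)

  degenerate-⊥ : ∀ {f} → StrictlyDegenerate K f (induced K ⊥)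
  degenerate-⊥ _ K′⊑ (_ , x∈K′) = contradiction (proj₁ K′⊑ x∈K′) ∉⊥

  degenerate-∪ : ∀ {f S x} → StrictlyDegenerate K f (induced K S) →
                 degreeIn K (induced K (S ∪ ⁅ x ⁆)) x < f x →
                 StrictlyDegenerate K f (induced K (S ∪ ⁅ x ⁆))
  degenerate-∪ {f} {S} {x} degenerate dx<fx K′ (V⊆ , E⊆) nonempty with x ∈? Subgraph.vertices K′
  ... | yes x∈K′ = x , x∈K′ , ≤-<-trans (p⊆q⇒∣p∣≤∣q∣ λ e∈ →
          let e∈K′ , e∈x = x∈p∩q⁻ (Subgraph.edges K′) ⟪ incident? K x ⟫ e∈ in
          x∈p∩q⁺ (E⊆ e∈K′ , e∈x)) dx<fx
  ... | no  x∉K′ = degenerate K′ (V⊆S , E⊆S) nonempty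
    where
    V⊆S : Subgraph.vertices K′ ⊆ S
    V⊆S y∈K′ with x∈p∪q⁻ S ⁅ x ⁆ (V⊆ y∈K′)
    ... | inj₁ y∈S = y∈S
    ... | inj₂ y∈x = contradiction (subst (_∈ Subgraph.vertices K′) (x∈⁅y⁆⇒x≡y x y∈x) y∈K′) x∉K′

    E⊆S : Subgraph.edges K′ ⊆ ⟪ bothEndsIn? K S ⟫
    E⊆S e∈K′ = let e₁∈ , e₂∈ = Subgraph.closed K′ e∈K′ in
      ∈⟪⟫⁺ (bothEndsIn? K S) (V⊆S e₁∈ , V⊆S e₂∈)

  -- An order for the greedy colouring after D has been coloured: every vertex
  -- other than u still has an uncoloured neighbour r when its turn comes.
  data Peeling (u : Vertex K) : Subset (order K) → Set where
    done : Peeling u (∁ ⁅ u ⁆)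
    peel : ∀ {D w r e} → w ∉ D → r ∉ D → Joins K r w e → Peeling u (D ∪ ⁅ w ⁆) → Peeling u D

  module _ {u : Vertex K} {S : Subset (order K)} (L : Subgraph K)
           (avoids : ∀ {x} → x ∈ Subgraph.vertices L → x ∉ S)
           -- Doubly negated walks suffice because crossing? below is decidable.
           (reachable : ∀ {a} → a ∉ S → ¬ ¬ Walk K L u a) where

    private
      Crossing : Subset (order K) → Vertex K → Vertex K → Edge K → Set
      Crossing D r w e = (w ∈ D × w ∉ S) × r ∉ D × Joins K r w e

      crossing? : ∀ D → Dec (∃[ r ] ∃[ w ] ∃[ e ] Crossing D r w e)
      crossing? D = any? λ r → any? λ w → any? λ e →
        (w ∈? D ×-dec ¬? (w ∈? S)) ×-dec ¬? (r ∈? D) ×-dec joins? K r w e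

      target∉S : ∀ {x y} → Adjacent K L x y → y ∉ S
      target∉S (e , e∈L , inj₁ (_ , refl)) = avoids (proj₂ (Subgraph.closed L e∈L))
      target∉S (e , e∈L , inj₂ (refl , _)) = avoids (proj₁ (Subgraph.closed L e∈L))

      walk-stays-out : ∀ {D} → ¬ (∃[ r ] ∃[ w ] ∃[ e ] Crossing D r w e) →
                       ∀ {x y} → Walk K L x y → x ∉ D → y ∉ D
      walk-stays-out none ε        x∉D = x∉D
      walk-stays-out none (step@(e , _ , joins) ◅ walk) x∉D = walk-stays-out none walk
        λ z∈D → none (_ , _ , e , (z∈D , target∉S step) , x∉D , joins)

    extend-peeling : ∀ {D} → Acc _<_ ∣ D ∣ → S ⊆ D → u ∉ D → Peeling u D → Peeling u S
    extend-peeling {D} (acc rec) S⊆D u∉D peeling with crossing? D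
    ... | yes (r , w , e , (w∈D , w∉S) , r∉D , joins) =
      extend-peeling (rec (x∈p⇒∣p-x∣<∣p∣ w∈D))
        (λ {x} x∈S → x∈p∧x≢y⇒x∈p-y (S⊆D x∈S) λ { refl → w∉S x∈S })
        (λ u∈ → u∉D (p─q⊆p D ⁅ w ⁆ u∈))
        (peel w∉D-w (λ r∈ → r∉D (p─q⊆p D ⁅ w ⁆ r∈)) joins
          (subst (Peeling u) (sym restored) peeling))
      where
      w∉D-w : w ∉ D - w
      w∉D-w w∈ = <-irrefl refl (subst (λ p → ∣ D - w - w ∣ < ∣ p ∣)
        (sym (p─q─q≡p─q D ⁅ w ⁆)) (x∈p⇒∣p-x∣<∣p∣ w∈))

      restored : (D - w) ∪ ⁅ w ⁆ ≡ D
      restored = ⊆-antisym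
        (λ x∈ → [ p─q⊆p D ⁅ w ⁆ , (λ x∈w → subst (_∈ D) (sym (x∈⁅y⁆⇒x≡y w x∈w)) w∈D) ]′
                  (x∈p∪q⁻ (D - w) ⁅ w ⁆ x∈))
        λ {x} x∈D → x∈p∪q⁺ (keep x x∈D)
        where
        keep : ∀ x → x ∈ D → x ∈ D - w ⊎ x ∈ ⁅ w ⁆
        keep x x∈D with x ≟ w
        ... | yes refl = inj₂ (x∈⁅x⁆ w)
        ... | no  x≢w  = inj₁ (x∈p∧x≢y⇒x∈p-y x∈D x≢w)
    ... | no none = subst (Peeling u) (⊆-antisym D⊆S S⊆D) peeling
      where
      D⊆S : D ⊆ S
      D⊆S {a} a∈D with a ∈? S
      ... | yes a∈S = a∈S
      ... | no  a∉S = contradiction (λ walk → walk-stays-out none walk u∉D a∈D) (reachable a∉S)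

    reachable⇒peeling : u ∉ S → Peeling u S
    reachable⇒peeling u∉S = extend-peeling (<-wellFounded _)
      (λ x∈S → x∉p⇒x∈∁p λ x∈u → u∉S (subst (_∈ S) (x∈⁅y⁆⇒x≡y u x∈u) x∈S))
      (x∈p⇒x∉∁p (x∈⁅x⁆ u)) done

module _ (C : Configuration) where
  open Configuration C

  Degenerate : Subset (order H) → Set
  Degenerate T = StrictlyDegenerate H f (induced H T)

  sum-μ≤μ : ∀ {u w z} → w ≢ u → z ∈ X w → (∑[ y ∈ X u ] μ H y z) ≤ μ G w u
  sum-μ≤μ {u} {w} {z} w≢u z∈Xw with matchings w u w≢u
  ... | M , matching , between = ≤-trans (≤-reflexive (double-count (X u) J))
    (sum≤number-of-classes a M
      (λ e → sumOver-single-≤ {S = X u} (λ {y} _ → restrict-≤ (J y) (const 1) λ _ → ≤-refl)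
        λ {y} {y′} _ _ p q → joins-uniqueˡ H (joined p) (joined q))
      (λ e 0<ae → Equivalence.to (between e) (crosses (sumOver-positive {S = X u} 0<ae)))
      λ i e∈Mi e′∈Mi 0<ae 0<ae′ → matching i e∈Mi e′∈Mi
        (touches (sumOver-positive {S = X u} 0<ae)) (touches (sumOver-positive {S = X u} 0<ae′)))
    where
    J = λ y → ⟪ joins? H y z ⟫
    a : Edge H → ℕ
    a e = ∑[ y ∈ X u ] χ (J y) e

    joined : ∀ {y e} → 0 < χ (J y) e → Joins H y z e
    joined {y} p = ∈⟪⟫⁻ (joins? H y z) (χ-positive p)

    touches : ∀ {e} → (∃[ y ] y ∈ X u × 0 < χ (J y) e) → Incident H z e
    touches (_ , _ , p) = joins⇒incidentʳ H (joined p)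

    crosses : ∀ {e} → (∃[ y ] y ∈ X u × 0 < χ (J y) e) → Between H (X w) (X u) e
    crosses (y , y∈Xu , p) with joined p
    ... | inj₁ (refl , refl) = inj₂ (y∈Xu , z∈Xw)
    ... | inj₂ (refl , refl) = inj₁ (z∈Xw , y∈Xu)

  ∈dom⁺ : ∀ {T w z} → z ∈ X w → z ∈ T → w ∈ dom T
  ∈dom⁺ {T} z∈Xw z∈T = ∈⟪⟫⁺ (λ v → nonempty? (X v ∩ T)) (_ , x∈p∩q⁺ (z∈Xw , z∈T))

  ∈dom⁻ : ∀ {T w} → w ∈ dom T → ∃[ z ] z ∈ X w × z ∈ T
  ∈dom⁻ {T} {w} w∈ = map₂ (x∈p∩q⁻ (X w) T) (∈⟪⟫⁻ (λ v → nonempty? (X v ∩ T)) w∈)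

  dom-⊥ : dom ⊥ ≡ ⊥
  dom-⊥ = Empty-unique λ (w , w∈) → let _ , _ , z∈⊥ = ∈dom⁻ w∈ in ∉⊥ z∈⊥

  dom-∪ : ∀ T {w x} → x ∈ X w → dom (T ∪ ⁅ x ⁆) ≡ dom T ∪ ⁅ w ⁆
  dom-∪ T {w} {x} x∈Xw = ⊆-antisym to from
    where
    to : dom (T ∪ ⁅ x ⁆) ⊆ dom T ∪ ⁅ w ⁆
    to v∈ with ∈dom⁻ v∈
    ... | z , z∈Xv , z∈ with x∈p∪q⁻ T ⁅ x ⁆ z∈
    ...   | inj₁ z∈T = x∈p∪q⁺ (inj₁ (∈dom⁺ z∈Xv z∈T))
    ...   | inj₂ z∈x rewrite x∈⁅y⁆⇒x≡y x z∈x | disjoint z∈Xv x∈Xw = x∈p∪q⁺ (inj₂ (x∈⁅x⁆ w))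

    from : dom T ∪ ⁅ w ⁆ ⊆ dom (T ∪ ⁅ x ⁆)
    from v∈ with x∈p∪q⁻ (dom T) ⁅ w ⁆ v∈
    ... | inj₁ v∈T = let _ , z∈Xv , z∈T = ∈dom⁻ v∈T in ∈dom⁺ z∈Xv (p⊆p∪q ⁅ x ⁆ z∈T)
    ... | inj₂ v∈w rewrite x∈⁅y⁆⇒x≡y w v∈w = ∈dom⁺ x∈Xw (q⊆p∪q T ⁅ x ⁆ (x∈⁅x⁆ x))

  partial-⊥ : PartialTransversal ⊥
  partial-⊥ v = unique⇒∣∣≤1 λ x∈ _ → contradiction (proj₁ (x∈p∩q⁻ ⊥ (X v) x∈)) ∉⊥

  partial-∪ : ∀ {T w x} → PartialTransversal T → w ∉ dom T → x ∈ X w → PartialTransversal (T ∪ ⁅ x ⁆)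
  partial-∪ {T} {w} {x} partial w∉T x∈Xw v = unique⇒∣∣≤1 λ y∈ z∈ →
    let y∈T∪x , y∈Xv = x∈p∩q⁻ (T ∪ ⁅ x ⁆) (X v) y∈
        z∈T∪x , z∈Xv = x∈p∩q⁻ (T ∪ ⁅ x ⁆) (X v) z∈
    in same y∈Xv z∈Xv (x∈p∪q⁻ T ⁅ x ⁆ y∈T∪x) (x∈p∪q⁻ T ⁅ x ⁆ z∈T∪x)
    where
    fresh : ∀ {y z} → y ∈ X v → z ∈ X v → y ∈ T → z ∉ ⁅ x ⁆
    fresh y∈Xv z∈Xv y∈T z∈x rewrite x∈⁅y⁆⇒x≡y x z∈x | disjoint z∈Xv x∈Xw = w∉T (∈dom⁺ y∈Xv y∈T)

    same : ∀ {y z} → y ∈ X v → z ∈ X v → y ∈ T ⊎ y ∈ ⁅ x ⁆ → z ∈ T ⊎ z ∈ ⁅ x ⁆ → y ≡ z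
    same y∈Xv z∈Xv (inj₁ y∈T) (inj₁ z∈T) =
      ∣∣-unique (partial v) (x∈p∩q⁺ (y∈T , y∈Xv)) (x∈p∩q⁺ (z∈T , z∈Xv))
    same y∈Xv z∈Xv (inj₁ y∈T) (inj₂ z∈x) = contradiction z∈x (fresh y∈Xv z∈Xv y∈T)
    same y∈Xv z∈Xv (inj₂ y∈x) (inj₁ z∈T) = contradiction y∈x (fresh z∈Xv y∈Xv z∈T)
    same y∈Xv z∈Xv (inj₂ y∈x) (inj₂ z∈x) = trans (x∈⁅y⁆⇒x≡y x y∈x) (sym (x∈⁅y⁆⇒x≡y x z∈x))

  total⇒transversal : ∀ {T} → PartialTransversal T → (∀ v → v ∈ dom T) → Transversal T
  total⇒transversal {T} partial total v = ≤-antisym (partial v)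
    (nonempty⇒∣∣≥1 (let z , z∈Xv , z∈T = ∈dom⁻ (total v) in z , x∈p∩q⁺ (z∈T , z∈Xv)))

  module _ {T : Subset (order H)} {u : Vertex G} (partial : PartialTransversal T) (u∉T : u ∉ dom T) where

    fibre : Vertex G → ℕ
    fibre w = ∑[ z ∈ T ∩ X w ] ∑[ y ∈ X u ] μ H y z

    fibre≤μ : ∀ {w} → w ∈ dom T → fibre w ≤ μ G w u
    fibre≤μ {w} w∈T = sumOver-single-≤ {S = T ∩ X w}
      (λ z∈ → sum-μ≤μ (λ { refl → u∉T w∈T }) (proj₂ (x∈p∩q⁻ T (X w) z∈)))
      λ z∈ z′∈ _ _ → ∣∣-unique (partial w) z∈ z′∈

    sum-fibre≤sum-μ : sumOver (dom T) fibre ≤ (∑[ w ∈ dom T ] μ G w u)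
    sum-fibre≤sum-μ = sumOver-≤ fibre≤μ

    sum-μ≤sum-fibre : (∑[ y ∈ X u ] ∑[ z ∈ T ] μ H y z) ≤ sumOver (dom T) fibre
    sum-μ≤sum-fibre = ≤-trans (≤-reflexive (sumOver-comm (X u) T (μ H)))
      (sumOver-cover-≤ T (dom T) (λ w → T ∩ X w) (λ z → ∑[ y ∈ X u ] μ H y z)
        λ {z} z∈T → let w , z∈Xw = covering z in w , ∈dom⁺ z∈Xw z∈T , x∈p∩q⁺ (z∈T , z∈Xw))

  deg : Subset (order H) → Vertex H → ℕ
  deg T x = degreeIn H (induced H (T ∪ ⁅ x ⁆)) x

  sum-deg≤sum-μH : ∀ T u → (∑[ x ∈ X u ] deg T x) ≤ (∑[ x ∈ X u ] ∑[ z ∈ T ] μ H x z)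
  sum-deg≤sum-μH T u = sumOver-≤ {S = X u} {f = deg T} λ {x} _ → degreeIn-induced≤ H T x

  sum-deg≤sum-μ : ∀ {T u} → PartialTransversal T → u ∉ dom T →
                  (∑[ x ∈ X u ] deg T x) ≤ (∑[ w ∈ dom T ] μ G w u)
  sum-deg≤sum-μ {T} {u} partial u∉T = ≤-trans (sum-deg≤sum-μH T u)
    (≤-trans (sum-μ≤sum-fibre partial u∉T) (sum-fibre≤sum-μ partial u∉T))

  module _ (feasible : DegreeFeasible) where

    free-colour : ∀ {T w r e} → PartialTransversal T → w ∉ dom T → r ∉ dom T → Joins G r w e →
                  ∃[ x ] x ∈ X w × deg T x < f x
    free-colour {T} {w} {r} {e} partial w∉T r∉T joins = sumOver-<⇒∃< (begin-strict
      (∑[ x ∈ X w ] deg T x)        ≤⟨ sum-deg≤sum-μ partial w∉T ⟩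
      (∑[ v ∈ dom T ] μ G v w)      <⟨ sumOver-⊂-< ⊆⊤ ∈⊤ r∉T (nonempty⇒∣∣≥1 (e , ∈⟪⟫⁺ (joins? G r w) joins)) ⟩
      (∑[ v ∈ ⊤ ] μ G v w)          ≤⟨ sum-μ≤degree G ⊤ w ⟩
      degree G w                    ≤⟨ feasible w ⟩
      (∑[ x ∈ X w ] f x)            ∎)
      where open ≤-Reasoning

    greedy : ∀ {u D T} → Peeling G u D → PartialTransversal T → Degenerate T → dom T ≡ D →
             ∃[ T′ ] T ⊆ T′ × PartialTransversal T′ × Degenerate T′ × dom T′ ≡ ∁ ⁅ u ⁆
    greedy done partial degenerate dom≡ = _ , id , partial , degenerate , dom≡
    greedy {T = T} (peel w∉ r∉ joins rest) partial degenerate refl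
      with free-colour partial w∉ r∉ joins
    ... | x , x∈Xw , d<f with greedy rest (partial-∪ partial w∉ x∈Xw) (degenerate-∪ H degenerate d<f)
             (dom-∪ T x∈Xw)
    ...   | T′ , T∪x⊆T′ , good = T′ , T∪x⊆T′ ∘ p⊆p∪q ⁅ x ⁆ , good

    module _ (uncolorable : Uncolorable) where

      module Saturated {T u} (partial : PartialTransversal T) (degenerate : Degenerate T)
                       (dom≡ : dom T ≡ ∁ ⁅ u ⁆) where

        u∉T : u ∉ dom T
        u∉T u∈T = x∈p⇒x∉∁p (x∈⁅x⁆ u) (subst (u ∈_) dom≡ u∈T)

        f≤deg : ∀ {x} → x ∈ X u → f x ≤ deg T x
        f≤deg {x} x∈Xu = ≮⇒≥ λ d<f → uncolorable
          ( T ∪ ⁅ x ⁆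
          , total⇒transversal (partial-∪ partial u∉T x∈Xu) (λ v → subst (v ∈_) (sym total) ∈⊤)
          , degenerate-∪ H degenerate d<f )
          where
          total : dom (T ∪ ⁅ x ⁆) ≡ ⊤
          total = trans (dom-∪ T x∈Xu) (trans (cong (_∪ ⁅ u ⁆) dom≡)
                    (trans (∪-comm (∁ ⁅ u ⁆) ⁅ u ⁆) (p∪∁p≡⊤ ⁅ u ⁆)))

        sum-f≤sum-deg : (∑[ x ∈ X u ] f x) ≤ (∑[ x ∈ X u ] deg T x)
        sum-f≤sum-deg = sumOver-≤ f≤deg

        sum-μG≤sum-f : (∑[ w ∈ dom T ] μ G w u) ≤ (∑[ x ∈ X u ] f x)
        sum-μG≤sum-f = ≤-trans (sum-μ≤degree G (dom T) u) (feasible u)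

        sum-f≡degree : (∑[ x ∈ X u ] f x) ≡ degree G u
        sum-f≡degree = ≤-antisym
          (≤-trans sum-f≤sum-deg (≤-trans (sum-deg≤sum-μ partial u∉T) (sum-μ≤degree G (dom T) u)))
          (feasible u)

        f≡deg : ∀ {x} → x ∈ X u → f x ≡ deg T x
        f≡deg = sumOver-≥⇒≡ f≤deg (≤-trans (sum-deg≤sum-μ partial u∉T) sum-μG≤sum-f)

        f≡sum-μ : ∀ {x} → x ∈ X u → f x ≡ (∑[ z ∈ T ] μ H x z)
        f≡sum-μ = sumOver-≥⇒≡ (λ {x} x∈Xu → ≤-trans (f≤deg x∈Xu) (degreeIn-induced≤ H T x))
          (≤-trans (sum-μ≤sum-fibre partial u∉T) (≤-trans (sum-fibre≤sum-μ partial u∉T) sum-μG≤sum-f))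

        fibre≡μ : ∀ {w} → w ∈ dom T → fibre partial u∉T w ≡ μ G w u
        fibre≡μ = sumOver-≥⇒≡ (fibre≤μ partial u∉T) (≤-trans sum-μG≤sum-f
          (≤-trans sum-f≤sum-deg (≤-trans (sum-deg≤sum-μH T u) (sum-μ≤sum-fibre partial u∉T))))

proposition13 : (C : Configuration) → let open Configuration C in
    Connected G → Uncolorable → DegreeFeasible →
    (∀ u → (∑[ x ∈ X u ] f x) ≡ degree G u)
    ×
    (∀ v → ¬ Separating G v → ∀ xᵥ → xᵥ ∈ X v → f xᵥ > 0 →
    ∀ u → u ≢ v →
    (∀ y → y ∈ X u → f y ≥ μ H y xᵥ) ×
    μ G v u ≡ (∑[ y ∈ X u ] μ H y xᵥ))
    ×
    (order G ≥ 2 → ∀ u →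
    (∃[ T ] PartialTransversal T × dom T ≡ ∁ ⁅ u ⁆ × StrictlyDegenerate H f (induced H T)) ×
    (∀ T → PartialTransversal T → dom T ≡ ∁ ⁅ u ⁆ → StrictlyDegenerate H f (induced H T) →
    ∀ x → x ∈ X u → f x ≡ degreeIn H (induced H (T ∪ ⁅ x ⁆)) x))
proposition13 C (_ , walk) uncolorable feasible = part-a , part-b , part-c
  where
  open Configuration C

  near-transversal : ∀ u → ∃[ T ] ⊥ ⊆ T × PartialTransversal T × Degenerate C T × dom T ≡ ∁ ⁅ u ⁆
  near-transversal u = greedy C feasible
    (reachable⇒peeling G (whole G) (λ _ → ∉⊥) (λ {a} _ none → none (walk u a)) ∉⊥)
    (partial-⊥ C) (degenerate-⊥ H) (dom-⊥ C)

  part-a : ∀ u → (∑[ x ∈ X u ] f x) ≡ degree G u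
  part-a u = let _ , _ , partial , degenerate , dom≡ = near-transversal u in
    Saturated.sum-f≡degree C feasible uncolorable partial degenerate dom≡

  part-b : ∀ v → ¬ Separating G v → ∀ xᵥ → xᵥ ∈ X v → f xᵥ > 0 → ∀ u → u ≢ v →
           (∀ y → y ∈ X u → f y ≥ μ H y xᵥ) × μ G v u ≡ (∑[ y ∈ X u ] μ H y xᵥ)
  part-b v ¬separating x x∈Xv fx>0 u u≢v
    with greedy C feasible {T = ⊥ ∪ ⁅ x ⁆}
           (reachable⇒peeling G (delete G v) x∈∁p⇒x∉p
             (λ a∉v none → ¬separating (u , _ , x∉p⇒x∈∁p u∉v , x∉p⇒x∈∁p a∉v , none)) u∉v)
           (partial-∪ C (partial-⊥ C) (λ v∈ → ∉⊥ (subst (v ∈_) (dom-⊥ C) v∈)) x∈Xv)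
           (degenerate-∪ H (degenerate-⊥ H) (≤-<-trans
             (≤-trans (degreeIn-induced≤ H ⊥ x) (sumOver-single-≤ {S = ⊥} {f = μ H x} (λ z∈⊥ → contradiction z∈⊥ ∉⊥)
               λ z∈⊥ → contradiction z∈⊥ ∉⊥)) fx>0))
           (trans (dom-∪ C ⊥ x∈Xv) (trans (cong (_∪ ⁅ v ⁆) (dom-⊥ C)) (∪-identityˡ ⁅ v ⁆)))
    where
    u∉v : u ∉ ⁅ v ⁆
    u∉v u∈v = u≢v (x∈⁅y⁆⇒x≡y v u∈v)
  ... | T , x∪⊆T , partial , degenerate , dom≡ =
    (λ y y∈Xu → ≤-trans (∈≤sumOver T (μ H y) x∈T) (≤-reflexive (sym (f≡sum-μ y∈Xu)))) ,
    ≤-antisym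
      (≤-trans (≤-reflexive (sym (fibre≡μ (∈dom⁺ C x∈Xv x∈T))))
        (sumOver-single-≤ {S = T ∩ X v}
          (λ z∈ → ≤-reflexive (cong (λ z → ∑[ y ∈ X u ] μ H y z)
            (∣∣-unique (partial v) z∈ (x∈p∩q⁺ (x∈T , x∈Xv)))))
          λ z∈ z′∈ _ _ → ∣∣-unique (partial v) z∈ z′∈))
      (sum-μ≤μ C (u≢v ∘ sym) x∈Xv)
    where
    open Saturated C feasible uncolorable partial degenerate dom≡
    x∈T : x ∈ T
    x∈T = x∪⊆T (q⊆p∪q ⊥ ⁅ x ⁆ (x∈⁅x⁆ x))

  part-c : order G ≥ 2 → ∀ u →
    (∃[ T ] PartialTransversal T × dom T ≡ ∁ ⁅ u ⁆ × Degenerate C T) ×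
    (∀ T → PartialTransversal T → dom T ≡ ∁ ⁅ u ⁆ → Degenerate C T →
     ∀ x → x ∈ X u → f x ≡ deg C T x)
  part-c _ u =
    (let T , _ , partial , degenerate , dom≡ = near-transversal u in T , partial , dom≡ , degenerate) ,
    λ T partial dom≡ degenerate x → Saturated.f≡deg C feasible uncolorable partial degenerate dom≡
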